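{- There is a partial Boolean function $f:\{0,1\}^n\to\{0,1,*\}$ such that $\mathsf R(f)\geq\Omega(n)$ but $\mathsf{CG}^{\mathrm{pub}}(f)\leq O(1)$. That is, there exist absolute constants $c,C>0$ and $n_0$ such that for every $n\ge n_0$ there is a partial Boolean function $f:\{0,1\}^n\to\{0,1,*\}$ with $\mathsf R(f)\ge cn$ and $\mathsf{CG}^{\mathrm{pub}}(f)\le C$.
   Context: For a partial function $f:\{0,1\}^n\to\{0,1,*\}$ the domain is $f^{ -1}(0)\cup f^{ -1}(1)$. $[n]=\{1,\dots,n\}$. Public coin certificate game complexity: one player receives $x\in f^{ -1}(0)$, the other $y\in f^{ -1}(1)$; without communication they must output a common index $i$ with $x_i\ne y_i$. A deterministic strategy is a pair $(A,B)$ with $A:f^{ -1}(0)\to[n]$, $B:f^{ -1}(1)\to[n]$; it is correct on $(x,y)$ if $A(x)=B(y)=i$ with $x_i\ne y_i$. Then $\mathsf{CG}^{\mathrm{pub}}(f)=\min_{p}\max_{x\in f^{ -1}(0),y\in f^{ -1}(1)}\Big(\sum_{(A,B)\text{ correct on }(x,y)}p_{A,B}\Big)^{ -1}$, with $p$ ranging over probability distributions on pairs $(A,B)$ of deterministic strategies, and $1/0=+\infty$. $\mathsf R(f)$ is the randomized query complexity: the least $d$ such that some probability distribution over deterministic decision trees of depth at most $d$ (each query reveals one bit of the input) outputs $f(x)$ with probability at least $2/3$ on every input $x$ in the domain of $f$.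
   Formalization: The probability distributions over decision trees and over strategy pairs have rational weights instead of real ones; both complexity measures keep their values, since a finite system of linear inequalities with rational coefficients that is solvable over the reals is solvable over the rationals. -}

module Defs where

open import Data.Bool.Base using (Bool; true; false; if_then_else_)
import Data.Bool.Properties as Bool
open import Data.Fin.Base using (Fin)
import Data.Fin.Properties as Fin
open import Data.Integer.Base using (+_)
open import Data.List.Base using (List; []; _∷_; map)
open import Data.List.Relation.Unary.All using (All)
open import Data.Maybe.Base using (Maybe; just)
open import Data.Nat.Base as ℕ using (ℕ; suc; _⊔_)
open import Data.Product.Base using (∃; _×_; _,_; proj₁; proj₂)
open import Data.Rational.Base using (ℚ; 0ℚ; 1ℚ; _+_; _≤_; _/_; 1/_; ≢-nonZero)
import Data.Rational.Properties as ℚ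
open import Data.Vec.Base using (Vec; lookup)
open import Level using (0ℓ)
open import Relation.Binary.Construct.Add.Supremum.NonStrict _≤_ using (_≤⁺_)
open import Relation.Binary.PropositionalEquality.Core using (_≡_; _≢_)
open import Relation.Nullary.Construct.Add.Supremum using (_⁺; [_]; ⊤⁺)
open import Relation.Nullary.Decidable using (does; yes; no; _×-dec_; ¬?)
open import Relation.Unary using (Pred; Decidable)

fromℕ : ℕ → ℚ
fromℕ n = + n / 1

Input : ℕ → Set
Input n = Vec Bool n

-- `nothing` is the value *, `just false` is 0 and `just true` is 1.
PartialFunction : ℕ → Set
PartialFunction n = Input n → Maybe Bool

-- f⁻¹(b).  Since Maybe Bool has decidable equality, the proof component is
-- unique, so a function on f ⁻¹[ b ] depends on the input only.
_⁻¹[_] : ∀ {n} → PartialFunction n → Bool → Set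
f ⁻¹[ b ] = ∃ λ x → f x ≡ just b

sum : List ℚ → ℚ
sum []       = 0ℚ
sum (q ∷ qs) = q + sum qs

-- Finitely supported probability distributions, as weighted lists; an outcome
-- may be listed several times, its probability being the total of its weights.
-- Rational weights lose nothing here: up to redundant queries there are
-- finitely many trees of a given depth, and finitely many strategies, so both
-- complexity measures below are governed by linear programs with rational
-- coefficients, which are feasible over ℝ iff over ℚ and whose optima are
-- attained at rational points.
record Distribution (A : Set) : Set where
  field
    weighted    : List (ℚ × A)
    nonNegative : All (λ wa → 0ℚ ≤ proj₁ wa) weighted
    total       : sum (map proj₁ weighted) ≡ 1ℚ

Pr : ∀ {A : Set} → Distribution A → {P : Pred A 0ℓ} → Decidable P → ℚ
Pr D P? = sum (map (λ (w , a) → if does (P? a) then w else 0ℚ) weighted)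
  where open Distribution D

data DecisionTree (n : ℕ) : Set where
  leaf  : Bool → DecisionTree n
  query : Fin n → (t₀ t₁ : DecisionTree n) → DecisionTree n

depth : ∀ {n} → DecisionTree n → ℕ
depth (leaf _)        = 0
depth (query _ t₀ t₁) = suc (depth t₀ ⊔ depth t₁)

eval : ∀ {n} → DecisionTree n → Input n → Bool
eval (leaf b)        x = b
eval (query i t₀ t₁) x = if lookup x i then eval t₁ x else eval t₀ x

BoundedTree : ℕ → ℕ → Set
BoundedTree n d = ∃ λ (t : DecisionTree n) → depth t ℕ.≤ d

RandomizedlyComputableIn : ∀ {n} → PartialFunction n → ℕ → Set
RandomizedlyComputableIn {n} f d =
  ∃ λ (D : Distribution (BoundedTree n d)) →
    ∀ b ((x , _) : f ⁻¹[ b ]) →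
      + 2 / 3 ≤ Pr D (λ (t , _) → eval t x Bool.≟ b)

-- R(f) is the least d with RandomizedlyComputableIn f d; it is at least r
-- precisely when r is a lower bound of all such d.
R[_]≥_ : ∀ {n} → PartialFunction n → ℚ → Set
R[ f ]≥ r = ∀ d → RandomizedlyComputableIn f d → r ≤ fromℕ d

Strategy : ∀ {n} → PartialFunction n → Set
Strategy {n} f = (f ⁻¹[ false ] → Fin n) × (f ⁻¹[ true ] → Fin n)

Correct : ∀ {n} (f : PartialFunction n) →
          f ⁻¹[ false ] → f ⁻¹[ true ] → Strategy f → Set
Correct f x y (A , B) =
  A x ≡ B y × lookup (proj₁ x) (A x) ≢ lookup (proj₁ y) (A x)

correct? : ∀ {n} (f : PartialFunction n) x y → Decidable (Correct f x y)
correct? f x y (A , B) =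
  (A x Fin.≟ B y) ×-dec
  ¬? (lookup (proj₁ x) (A x) Bool.≟ lookup (proj₁ y) (A x))

-- The reciprocal with 1/0 = +∞; ⊤⁺ is +∞.
inverse : ℚ → ℚ ⁺
inverse p with p ℚ.≟ 0ℚ
... | yes _  = ⊤⁺
... | no p≢0 = [ (1/ p) {{≢-nonZero p≢0}} ]

-- CGᵖᵘᵇ(f) is a minimum over p of a maximum over (x , y); it is at most C
-- precisely when some p makes the expression at most C at every (x , y).
CGpub[_]≤_ : ∀ {n} → PartialFunction n → ℚ → Set
CGpub[ f ]≤ C =
  ∃ λ (p : Distribution (Strategy f)) →
    ∀ x y → inverse (Pr p (correct? f x y)) ≤⁺ [ C ]

{-# OPTIONS --safe #-}
module Submission where

-- Take a linear code C ⊂ 𝔽₂ⁿ of dimension n/2 (up to rounding) any k ≈ n/20 of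
-- whose coordinates are independent, and a vector v at distance more than k from
-- C; both exist by counting. Let f be 0 on C and 1 on C + v. A 0-input and
-- a 1-input differ in more than k places, so a common random index wins the
-- certificate game with probability at least 1/20. A tree of depth at most k is a
-- combination of characters of weight at most k. The nonconstant ones average to
-- 0 over C and over C + v, so such a tree outputs 0 equally often on both.

open import Defs
open import Data.Bool.Base using (Bool; true; false; not; _∧_; _xor_; if_then_else_)
import Data.Bool.Properties as Bool
open import Data.Fin.Base using (Fin; zero; suc)
import Data.Fin.Properties as Fin
open import Data.Fin.Subset using (∣_∣)
open import Data.Integer.Base as ℤ using (+_)
import Data.Integer.Properties as ℤ
open import Data.List.Base using (List; []; _∷_; _++_; length; map; tabulate; cartesianProductWith)
open import Data.List.Properties using (length-map; length-++; map-tabulate; tabulate-cong)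
open import Data.List.Membership.Propositional using (_∈_; _∉_)
import Data.List.Membership.DecPropositional as DecMembership
open import Data.List.Membership.Propositional.Properties
  using (∈-map⁺; ∈-map⁻; ∈-++⁺ˡ; ∈-++⁺ʳ; ∈-cartesianProductWith⁺)
open import Data.List.Relation.Unary.All.Properties using (tabulate⁺)
open import Data.List.Relation.Unary.Any using (here; there)
open import Data.Maybe.Base using (just; nothing)
open import Data.Nat.Base as ℕ using (ℕ; zero; suc; z≤n; s≤s)
import Data.Nat.Properties as ℕ
open import Data.Nat.DivMod using (m≡m%n+[m/n]*n; m%n<n; m/n*n≤m; /-monoˡ-≤)
open import Data.Nat.Tactic.RingSolver using () renaming (solve-∀ to ℕ-solve-∀)
open import Data.Product.Base using (∃; _×_; _,_; proj₁; proj₂)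
open import Data.Rational.Base using (ℚ; 0ℚ; 1ℚ; ½; toℚᵘ; _<_; _≤_; _+_; _*_; -_; _/_; 1/_;
  NonNegative; Positive; positive; nonNegative; ≢-nonZero)
import Data.Rational.Properties as ℚ
import Data.Rational.Unnormalised.Base as ℚᵘ
import Data.Rational.Unnormalised.Properties as ℚᵘ
open import Data.Rational.Solver using (module +-*-Solver)
open import Data.Unit.Base using (tt)
open import Data.Vec.Base as Vec using (Vec; []; _∷_; lookup; replicate; updateAt; zipWith)
import Data.Vec.Properties as Vec
open import Function.Base using (_∘_; const)
open import Relation.Binary.PropositionalEquality using (_≡_; _≢_; _≗_; refl; sym; trans; cong; cong₂;
  subst; subst₂; module ≡-Reasoning)
open import Relation.Nullary using (yes; no; does; contradiction)
open import Relation.Nullary.Decidable using (dec-true; dec-false; from-no; from-yes)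
open import Relation.Binary.Construct.Add.Supremum.NonStrict _≤_ using (_≤⁺_; [_])
open import Relation.Nullary.Construct.Add.Supremum using ([_])

-- Linear algebra over 𝔽₂

infixl 6 _⊕_

_⊕_ : ∀ {n} → Vec Bool n → Vec Bool n → Vec Bool n
_⊕_ = zipWith _xor_

𝟎 : ∀ {n} → Vec Bool n
𝟎 = replicate _ false

⊕-cancelˡ : ∀ {n} (x y : Vec Bool n) → x ⊕ (x ⊕ y) ≡ y
⊕-cancelˡ []      []      = refl
⊕-cancelˡ (a ∷ x) (b ∷ y) = cong₂ _∷_ (xor-cancelˡ a b) (⊕-cancelˡ x y)
  where
  xor-cancelˡ : ∀ a b → a xor (a xor b) ≡ b
  xor-cancelˡ false b = refl
  xor-cancelˡ true  b = Bool.not-involutive b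

⊕≡𝟎⇒≡ : ∀ {n} (x y : Vec Bool n) → x ⊕ y ≡ 𝟎 → x ≡ y
⊕≡𝟎⇒≡ x y eq = begin
  x           ≡⟨ Vec.zipWith-identityʳ Bool.xor-identityʳ x ⟨
  x ⊕ 𝟎       ≡⟨ cong (x ⊕_) eq ⟨
  x ⊕ (x ⊕ y) ≡⟨ ⊕-cancelˡ x y ⟩
  y           ∎
  where open ≡-Reasoning

xor-interchange : ∀ a b c d → (a xor b) xor (c xor d) ≡ (a xor c) xor (b xor d)
xor-interchange false b false d = refl
xor-interchange false b true  d = sym (Bool.not-distribʳ-xor b d)
xor-interchange true  b false d = sym (Bool.not-distribˡ-xor b d)
xor-interchange true  b true  d = Bool.xor-annihilates-not b d

⟨_,_⟩ : ∀ {m} → Vec Bool m → Vec Bool m → Bool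
⟨ []    , []    ⟩ = false
⟨ a ∷ u , b ∷ p ⟩ = (a ∧ b) xor ⟨ u , p ⟩

⟨⟩-comm : ∀ {m} (u p : Vec Bool m) → ⟨ u , p ⟩ ≡ ⟨ p , u ⟩
⟨⟩-comm []      []      = refl
⟨⟩-comm (a ∷ u) (b ∷ p) = cong₂ _xor_ (Bool.∧-comm a b) (⟨⟩-comm u p)

⟨⟩-𝟎ˡ : ∀ {m} (p : Vec Bool m) → ⟨ 𝟎 , p ⟩ ≡ false
⟨⟩-𝟎ˡ []      = refl
⟨⟩-𝟎ˡ (b ∷ p) = ⟨⟩-𝟎ˡ p

⟨⟩-⊕ˡ : ∀ {m} (u v p : Vec Bool m) → ⟨ u ⊕ v , p ⟩ ≡ ⟨ u , p ⟩ xor ⟨ v , p ⟩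
⟨⟩-⊕ˡ []      []      []      = refl
⟨⟩-⊕ˡ (a ∷ u) (b ∷ v) (c ∷ p) = begin
  ((a xor b) ∧ c) xor ⟨ u ⊕ v , p ⟩
    ≡⟨ cong₂ _xor_ (Bool.∧-distribʳ-xor c a b) (⟨⟩-⊕ˡ u v p) ⟩
  ((a ∧ c) xor (b ∧ c)) xor (⟨ u , p ⟩ xor ⟨ v , p ⟩)
    ≡⟨ xor-interchange (a ∧ c) (b ∧ c) ⟨ u , p ⟩ ⟨ v , p ⟩ ⟩
  ((a ∧ c) xor ⟨ u , p ⟩) xor ((b ∧ c) xor ⟨ v , p ⟩) ∎
  where open ≡-Reasoning

⟨⟩-⊕ʳ : ∀ {m} (u p q : Vec Bool m) → ⟨ u , p ⊕ q ⟩ ≡ ⟨ u , p ⟩ xor ⟨ u , q ⟩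
⟨⟩-⊕ʳ u p q = trans (⟨⟩-comm u (p ⊕ q))
  (trans (⟨⟩-⊕ˡ p q u) (cong₂ _xor_ (⟨⟩-comm p u) (⟨⟩-comm q u)))

flipAt : ∀ {n} → Fin n → Vec Bool n → Vec Bool n
flipAt i s = updateAt s i not

-- Flipping adds the `i`-th unit vector to `s`, and that vector pairs with `x` to the bit
-- `lookup x i`.
⟨⟩-flipAt : ∀ {n} (i : Fin n) (s x : Vec Bool n) → ⟨ flipAt i s , x ⟩ ≡ lookup x i xor ⟨ s , x ⟩
⟨⟩-flipAt zero    (false ∷ s) (a ∷ x)     = refl
⟨⟩-flipAt zero    (true ∷ s)  (false ∷ x) = refl
⟨⟩-flipAt zero    (true ∷ s)  (true ∷ x)  = sym (Bool.not-involutive _)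
⟨⟩-flipAt (suc i) (b ∷ s)     (a ∷ x)     =
  trans (cong ((b ∧ a) xor_) (⟨⟩-flipAt i s x))
        (xor-interchange false (b ∧ a) (lookup x i) ⟨ s , x ⟩)

∣flipAt∣≤ : ∀ {n} (i : Fin n) (s : Vec Bool n) → ∣ flipAt i s ∣ ℕ.≤ suc ∣ s ∣
∣flipAt∣≤ zero    (false ∷ s) = ℕ.≤-refl
∣flipAt∣≤ zero    (true ∷ s)  = ℕ.≤-trans (ℕ.n≤1+n _) (ℕ.n≤1+n _)
∣flipAt∣≤ (suc i) (false ∷ s) = ∣flipAt∣≤ i s
∣flipAt∣≤ (suc i) (true ∷ s)  = s≤s (∣flipAt∣≤ i s)

∣𝟎∣≡0 : ∀ n → ∣ 𝟎 {n} ∣ ≡ 0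
∣𝟎∣≡0 zero    = refl
∣𝟎∣≡0 (suc n) = ∣𝟎∣≡0 n

∣x⊕x∣≡0 : ∀ {n} (x : Vec Bool n) → ∣ x ⊕ x ∣ ≡ 0
∣x⊕x∣≡0 []          = refl
∣x⊕x∣≡0 (false ∷ x) = ∣x⊕x∣≡0 x
∣x⊕x∣≡0 (true ∷ x)  = ∣x⊕x∣≡0 x

-- P lists the columns of a generator matrix.
encode : ∀ {m n} → Vec (Vec Bool m) n → Vec Bool m → Vec Bool n
encode P u = Vec.map ⟨ u ,_⟩ P

-- The transposed map of `encode`; its kernel is the dual code.
combine : ∀ {m n} → Vec (Vec Bool m) n → Vec Bool n → Vec Bool m
combine []      []          = 𝟎
combine (p ∷ P) (false ∷ s) = combine P s
combine (p ∷ P) (true ∷ s)  = p ⊕ combine P s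

encode-⊕ : ∀ {m n} (P : Vec (Vec Bool m) n) u v → encode P (u ⊕ v) ≡ encode P u ⊕ encode P v
encode-⊕ []      u v = refl
encode-⊕ (p ∷ P) u v = cong₂ _∷_ (⟨⟩-⊕ˡ u v p) (encode-⊕ P u v)

-- `encode P` and `combine P` are adjoint. This turns the character `χ s` on codewords into the
-- character of `combine P s` on messages.
⟨⟩-encode : ∀ {m n} (P : Vec (Vec Bool m) n) s u → ⟨ s , encode P u ⟩ ≡ ⟨ u , combine P s ⟩
⟨⟩-encode []      []          u = trans (sym (⟨⟩-𝟎ˡ u)) (⟨⟩-comm 𝟎 u)
⟨⟩-encode (p ∷ P) (false ∷ s) u = ⟨⟩-encode P s u
⟨⟩-encode (p ∷ P) (true ∷ s)  u =
  trans (cong (⟨ u , p ⟩ xor_) (⟨⟩-encode P s u)) (sym (⟨⟩-⊕ʳ u p (combine P s)))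

-- Existence of the code by counting

words : ∀ n → List (Vec Bool n)
words zero    = [] ∷ []
words (suc n) = map (false ∷_) (words n) ++ map (true ∷_) (words n)

∈-words : ∀ {n} (s : Vec Bool n) → s ∈ words n
∈-words []          = here refl
∈-words (false ∷ s) = ∈-++⁺ˡ (∈-map⁺ _ (∈-words s))
∈-words (true ∷ s)  = ∈-++⁺ʳ (map (false ∷_) (words _)) (∈-map⁺ _ (∈-words s))

length-map-++-map : ∀ {n} (xs ys : List (Vec Bool n)) →
  length (map (false ∷_) xs ++ map (true ∷_) ys) ≡ length xs ℕ.+ length ys
length-map-++-map xs ys = trans (length-++ (map (false ∷_) xs))
  (cong₂ ℕ._+_ (length-map _ xs) (length-map _ ys))

length-words : ∀ n → length (words n) ≡ 2 ℕ.^ n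
length-words zero    = refl
length-words (suc n) = begin
  length (words (suc n))                  ≡⟨ length-map-++-map (words n) (words n) ⟩
  length (words n) ℕ.+ length (words n)   ≡⟨ cong₂ ℕ._+_ (length-words n) (length-words n) ⟩
  2 ℕ.^ n ℕ.+ 2 ℕ.^ n                     ≡⟨ cong (2 ℕ.^ n ℕ.+_) (ℕ.+-identityʳ _) ⟨
  2 ℕ.^ suc n                             ∎
  where open ≡-Reasoning

-- The Hamming ball of radius `k` about `𝟎`, listed by the first bit: a leading `true` uses up one
-- unit of the radius.
ball : ∀ n → ℕ → List (Vec Bool n)
ball zero    k       = [] ∷ []
ball (suc n) zero    = map (false ∷_) (ball n zero)
ball (suc n) (suc k) = map (false ∷_) (ball n (suc k)) ++ map (true ∷_) (ball n k)

∈-ball : ∀ {n k} (s : Vec Bool n) → ∣ s ∣ ℕ.≤ k → s ∈ ball n k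
∈-ball             []          _         = here refl
∈-ball {k = zero}  (false ∷ s) le        = ∈-map⁺ _ (∈-ball s le)
∈-ball {k = suc k} (false ∷ s) le        = ∈-++⁺ˡ (∈-map⁺ _ (∈-ball s le))
∈-ball {suc n} {suc k} (true ∷ s) (s≤s le) =
  ∈-++⁺ʳ (map (false ∷_) (ball n (suc k))) (∈-map⁺ _ (∈-ball s le))

length-ball-suc : ∀ n k → length (ball n k) ℕ.≤ length (ball (suc n) k)
length-ball-suc n zero    = ℕ.≤-reflexive (sym (length-map _ (ball n zero)))
length-ball-suc n (suc k) = ℕ.≤-trans (ℕ.m≤m+n _ _)
  (ℕ.≤-reflexive (sym (length-map-++-map (ball n (suc k)) (ball n k))))

length-ball-monoˡ : ∀ {m n} k → m ℕ.≤′ n → length (ball m k) ℕ.≤ length (ball n k)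
length-ball-monoˡ k ℕ.≤′-refl       = ℕ.≤-refl
length-ball-monoˡ k (ℕ.≤′-step m≤n) =
  ℕ.≤-trans (length-ball-monoˡ k m≤n) (length-ball-suc _ k)

-- The bound Vol(n,k) xᵏ ≤ (1 + x)ⁿ at x = 1/8, cleared of denominators.
length-ball-bound : ∀ n k → length (ball n k) ℕ.* 8 ℕ.^ n ℕ.≤ 9 ℕ.^ n ℕ.* 8 ℕ.^ k
length-ball-bound zero    k       = ℕ.≤-trans (ℕ.m^n>0 8 k) (ℕ.≤-reflexive (sym (ℕ.+-identityʳ _)))
length-ball-bound (suc n) zero    = begin
  length (ball (suc n) 0) ℕ.* (8 ℕ.* 8 ℕ.^ n) ≡⟨ cong (ℕ._* (8 ℕ.* 8 ℕ.^ n)) (length-map (false ∷_) (ball n 0)) ⟩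
  length (ball n 0) ℕ.* (8 ℕ.* 8 ℕ.^ n)       ≡⟨ swap (length (ball n 0)) (8 ℕ.^ n) ⟩
  8 ℕ.* (length (ball n 0) ℕ.* 8 ℕ.^ n)       ≤⟨ ℕ.*-mono-≤ (ℕ.n≤1+n 8) (length-ball-bound n 0) ⟩
  9 ℕ.* (9 ℕ.^ n ℕ.* 1)                       ≡⟨ ℕ.*-assoc 9 (9 ℕ.^ n) 1 ⟨
  9 ℕ.^ suc n ℕ.* 1                           ∎
  where
  open ℕ.≤-Reasoning
  swap : ∀ l e → l ℕ.* (8 ℕ.* e) ≡ 8 ℕ.* (l ℕ.* e)
  swap = ℕ-solve-∀
length-ball-bound (suc n) (suc k) = begin
  length (ball (suc n) (suc k)) ℕ.* (8 ℕ.* 8 ℕ.^ n)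
    ≡⟨ cong (ℕ._* (8 ℕ.* 8 ℕ.^ n)) (length-map-++-map (ball n (suc k)) (ball n k)) ⟩
  (length (ball n (suc k)) ℕ.+ length (ball n k)) ℕ.* (8 ℕ.* 8 ℕ.^ n)
    ≡⟨ expand (length (ball n (suc k))) (length (ball n k)) (8 ℕ.^ n) ⟩
  8 ℕ.* (length (ball n (suc k)) ℕ.* 8 ℕ.^ n) ℕ.+ 8 ℕ.* (length (ball n k) ℕ.* 8 ℕ.^ n)
    ≤⟨ ℕ.+-mono-≤ (ℕ.*-monoʳ-≤ 8 (length-ball-bound n (suc k)))
                  (ℕ.*-monoʳ-≤ 8 (length-ball-bound n k)) ⟩
  8 ℕ.* (9 ℕ.^ n ℕ.* (8 ℕ.* 8 ℕ.^ k)) ℕ.+ 8 ℕ.* (9 ℕ.^ n ℕ.* 8 ℕ.^ k)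
    ≡⟨ collect (9 ℕ.^ n) (8 ℕ.^ k) ⟩
  (9 ℕ.* 9 ℕ.^ n) ℕ.* (8 ℕ.* 8 ℕ.^ k) ∎
  where
  open ℕ.≤-Reasoning
  expand : ∀ l₁ l₀ e → (l₁ ℕ.+ l₀) ℕ.* (8 ℕ.* e) ≡ 8 ℕ.* (l₁ ℕ.* e) ℕ.+ 8 ℕ.* (l₀ ℕ.* e)
  expand = ℕ-solve-∀
  collect : ∀ a b → 8 ℕ.* (a ℕ.* (8 ℕ.* b)) ℕ.+ 8 ℕ.* (a ℕ.* b) ≡ (9 ℕ.* a) ℕ.* (8 ℕ.* b)
  collect = ℕ-solve-∀

^-distribʳ-* : ∀ k a b → (a ℕ.* b) ℕ.^ k ≡ a ℕ.^ k ℕ.* b ℕ.^ k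
^-distribʳ-* zero    a b = refl
^-distribʳ-* (suc k) a b =
  trans (cong (a ℕ.* b ℕ.*_) (^-distribʳ-* k a b)) (interchange a b (a ℕ.^ k) (b ℕ.^ k))
  where
  interchange : ∀ a b c d → a ℕ.* b ℕ.* (c ℕ.* d) ≡ a ℕ.* c ℕ.* (b ℕ.* d)
  interchange = ℕ-solve-∀

-- This is the case k = 2 + j. The inequality fails for k = 1 because 85² > 1024, so the induction
-- starts at 85³ < 1024²; afterwards the right side grows faster.
85^[1+k]<1024^k : ∀ j → 85 ℕ.^ (3 ℕ.+ j) ℕ.< 1024 ℕ.^ (2 ℕ.+ j)
85^[1+k]<1024^k zero    = ℕ.<ᵇ⇒< (85 ℕ.^ 3) (1024 ℕ.^ 2) tt
85^[1+k]<1024^k (suc j) =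
  ℕ.<-≤-trans (ℕ.*-monoʳ-< 85 (85^[1+k]<1024^k j))
              (ℕ.*-monoˡ-≤ (1024 ℕ.^ (2 ℕ.+ j)) (ℕ.≤ᵇ⇒≤ 85 1024 tt))

-- Enlarging the dimension to N = 20 (k + 1) makes it a multiple of k + 1, so the volume bound
-- becomes a (k + 1)-th power, at most 85^(k+1). Since 1024 = 2¹⁰, the comparison above gives the
-- claim.
length-ball< : ∀ n k → 2 ℕ.≤ k → n ℕ.≤ 20 ℕ.* suc k → length (ball n k) ℕ.< 2 ℕ.^ (10 ℕ.* k)
length-ball< n (suc zero) (s≤s ()) _
length-ball< n k@(suc (suc j)) _ n≤ = begin-strict
  length (ball n k) ≤⟨ length-ball-monoˡ k (ℕ.≤⇒≤′ n≤) ⟩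
  length (ball N k) ≤⟨ ℕ.*-cancelʳ-≤ _ _ (8 ℕ.^ N) {{ℕ.m^n≢0 8 N}} bound ⟩
  85 ℕ.^ suc k      <⟨ 85^[1+k]<1024^k j ⟩
  1024 ℕ.^ k        ≡⟨ ℕ.^-*-assoc 2 10 k ⟩
  2 ℕ.^ (10 ℕ.* k)  ∎
  where
  open ℕ.≤-Reasoning
  N = 20 ℕ.* suc k
  bound : length (ball N k) ℕ.* 8 ℕ.^ N ℕ.≤ 85 ℕ.^ suc k ℕ.* 8 ℕ.^ N
  bound = begin
    length (ball N k) ℕ.* 8 ℕ.^ N                 ≤⟨ length-ball-bound N k ⟩
    9 ℕ.^ N ℕ.* 8 ℕ.^ k                           ≤⟨ ℕ.*-monoʳ-≤ (9 ℕ.^ N) (ℕ.^-monoʳ-≤ 8 (ℕ.n≤1+n k)) ⟩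
    9 ℕ.^ N ℕ.* 8 ℕ.^ suc k                       ≡⟨ cong (ℕ._* 8 ℕ.^ suc k) (ℕ.^-*-assoc 9 20 (suc k)) ⟨
    (9 ℕ.^ 20) ℕ.^ suc k ℕ.* 8 ℕ.^ suc k          ≡⟨ ^-distribʳ-* (suc k) (9 ℕ.^ 20) 8 ⟨
    -- The constant 85 is 8 · (9/8)²⁰ ≈ 84.4 rounded up.
    (9 ℕ.^ 20 ℕ.* 8) ℕ.^ suc k                    ≤⟨ ℕ.^-monoˡ-≤ (suc k) (ℕ.≤ᵇ⇒≤ (9 ℕ.^ 20 ℕ.* 8) (85 ℕ.* 8 ℕ.^ 20) tt) ⟩
    (85 ℕ.* 8 ℕ.^ 20) ℕ.^ suc k                   ≡⟨ ^-distribʳ-* (suc k) 85 (8 ℕ.^ 20) ⟩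
    85 ℕ.^ suc k ℕ.* (8 ℕ.^ 20) ℕ.^ suc k         ≡⟨ cong (85 ℕ.^ suc k ℕ.*_) (ℕ.^-*-assoc 8 20 (suc k)) ⟩
    85 ℕ.^ suc k ℕ.* 8 ℕ.^ N                      ∎

length-cartesianProductWith : ∀ {A B C : Set} (f : A → B → C) xs ys →
  length (cartesianProductWith f xs ys) ≡ length xs ℕ.* length ys
length-cartesianProductWith f []       ys = refl
length-cartesianProductWith f (x ∷ xs) ys = trans (length-++ (map (f x) ys))
  (cong₂ ℕ._+_ (length-map (f x) ys) (length-cartesianProductWith f xs ys))

tailsAfter : ∀ {m} → Bool → List (Vec Bool (suc m)) → List (Vec Bool m)
tailsAfter b     []                  = []
tailsAfter false ((false ∷ x) ∷ L) = x ∷ tailsAfter false L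
tailsAfter false ((true ∷ x) ∷ L)  = tailsAfter false L
tailsAfter true  ((false ∷ x) ∷ L) = tailsAfter true L
tailsAfter true  ((true ∷ x) ∷ L)  = x ∷ tailsAfter true L

∈-tailsAfter : ∀ {m} b {v : Vec Bool m} L → b ∷ v ∈ L → v ∈ tailsAfter b L
∈-tailsAfter false ((false ∷ x) ∷ L) (here refl) = here refl
∈-tailsAfter true  ((true ∷ x) ∷ L)  (here refl) = here refl
∈-tailsAfter false ((false ∷ x) ∷ L) (there v∈)  = there (∈-tailsAfter false L v∈)
∈-tailsAfter false ((true ∷ x) ∷ L)  (there v∈)  = ∈-tailsAfter false L v∈
∈-tailsAfter true  ((false ∷ x) ∷ L) (there v∈)  = ∈-tailsAfter true L v∈
∈-tailsAfter true  ((true ∷ x) ∷ L)  (there v∈)  = there (∈-tailsAfter true L v∈)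

length-tailsAfter : ∀ {m} (L : List (Vec Bool (suc m))) →
  length (tailsAfter false L) ℕ.+ length (tailsAfter true L) ≡ length L
length-tailsAfter []                = refl
length-tailsAfter ((false ∷ x) ∷ L) = cong suc (length-tailsAfter L)
length-tailsAfter ((true ∷ x) ∷ L)  = trans (ℕ.+-suc _ _) (cong suc (length-tailsAfter L))

-- Pigeonhole by bisection: one of the two half-cubes contains fewer than 2^m entries of `L`, and
-- the search continues there with the tails of those entries.
avoid : ∀ {m} (L : List (Vec Bool m)) → length L ℕ.< 2 ℕ.^ m → ∃ λ v → v ∉ L
avoid {zero}  []      _        = [] , λ ()
avoid {zero}  (_ ∷ _) (s≤s ())
avoid {suc m} L       L<
  with length (tailsAfter false L) ℕ.<? 2 ℕ.^ m
... | yes F< = let v , v∉ = avoid (tailsAfter false L) F< in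
  false ∷ v , v∉ ∘ ∈-tailsAfter false L
... | no  F≮ = let v , v∉ = avoid (tailsAfter true L) T< in
  true ∷ v , v∉ ∘ ∈-tailsAfter true L
  where
  T< : length (tailsAfter true L) ℕ.< 2 ℕ.^ m
  T< = ℕ.+-cancelˡ-< (2 ℕ.^ m) _ _ (begin-strict
    2 ℕ.^ m ℕ.+ length (tailsAfter true L)
      ≤⟨ ℕ.+-monoˡ-≤ _ (ℕ.≮⇒≥ F≮) ⟩
    length (tailsAfter false L) ℕ.+ length (tailsAfter true L)
      ≡⟨ length-tailsAfter L ⟩
    length L
      <⟨ L< ⟩
    2 ℕ.^ suc m
      ≡⟨ cong (2 ℕ.^ m ℕ.+_) (ℕ.+-identityʳ _) ⟩
    2 ℕ.^ m ℕ.+ 2 ℕ.^ m ∎)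
    where open ℕ.≤-Reasoning

-- Any `k` columns are linearly independent; equivalently, every nonzero word of the dual code has
-- weight above `k`.
Independent : ∀ {m n} → ℕ → Vec (Vec Bool m) n → Set
Independent k P = ∀ s → ∣ s ∣ ℕ.≤ k → combine P s ≡ 𝟎 → s ≡ 𝟎

-- Gilbert–Varshamov: a further column need only avoid the sums of at most k earlier ones.
independentColumns : ∀ m n k → length (ball n k) ℕ.< 2 ℕ.^ m →
                     ∃ λ (P : Vec (Vec Bool m) n) → Independent k P
independentColumns m zero    k _ = [] , λ { [] _ _ → refl }
independentColumns m (suc n) k ball<
  with ball<′ ← ℕ.≤-<-trans (length-ball-suc n k) ball<
  with P , indep ← independentColumns m n k ball<′
  with p , p∉ ← avoid (map (combine P) (ball n k))
                      (subst (ℕ._< 2 ℕ.^ m) (sym (length-map _ (ball n k))) ball<′)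
  = p ∷ P , extended
  where
  extended : Independent k (p ∷ P)
  extended (false ∷ s) s≤k eq = cong (false ∷_) (indep s s≤k eq)
  extended (true ∷ s)  s<k eq = contradiction
    (subst (_∈ _) (sym (⊕≡𝟎⇒≡ p (combine P s) eq)) (∈-map⁺ (combine P) (∈-ball s (ℕ.<⇒≤ s<k))))
    p∉

-- The hypothesis says that the balls of radius `k` about the codewords are too small to cover the
-- whole space.
farVector : ∀ {m n} (P : Vec (Vec Bool m) n) k → 2 ℕ.^ m ℕ.* length (ball n k) ℕ.< 2 ℕ.^ n →
            ∃ λ v → ∀ u → k ℕ.< ∣ encode P u ⊕ v ∣
farVector {m} {n} P k small = v , far
  where
  shifted : Vec Bool m → Vec Bool n → Vec Bool n
  shifted u e = encode P u ⊕ e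
  near : List (Vec Bool n)
  near = cartesianProductWith shifted (words m) (ball n k)
  near< : length near ℕ.< 2 ℕ.^ n
  near< = subst (ℕ._< 2 ℕ.^ n)
    (sym (trans (length-cartesianProductWith shifted (words m) (ball n k))
                (cong (ℕ._* length (ball n k)) (length-words m))))
    small
  v : Vec Bool n
  v = proj₁ (avoid near near<)
  far : ∀ u → k ℕ.< ∣ encode P u ⊕ v ∣
  -- If the difference from the codeword of `u` lay in the ball, adding the codeword to it again
  -- would put `v` into `near`.
  far u = ℕ.≰⇒> λ close → proj₂ (avoid near near<)
    (subst (_∈ near) (⊕-cancelˡ (encode P u) v)
           (∈-cartesianProductWith⁺ shifted (∈-words u) (∈-ball _ close)))

-- Averages over 𝔽₂ᵐ

-- The uniform average, taken by conditioning on the first bit, so that its laws follow by induction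
-- on `m`.
𝔼 : ∀ {m} → (Vec Bool m → ℚ) → ℚ
𝔼 {zero}  g = g []
𝔼 {suc m} g = ½ * (𝔼 (g ∘ (false ∷_)) + 𝔼 (g ∘ (true ∷_)))

𝔼-cong : ∀ {m} {g h : Vec Bool m → ℚ} → g ≗ h → 𝔼 g ≡ 𝔼 h
𝔼-cong {zero}  g≗h = g≗h []
𝔼-cong {suc m} g≗h = cong (½ *_) (cong₂ _+_ (𝔼-cong (g≗h ∘ (false ∷_))) (𝔼-cong (g≗h ∘ (true ∷_))))

𝔼-+ : ∀ {m} (g h : Vec Bool m → ℚ) → 𝔼 (λ u → g u + h u) ≡ 𝔼 g + 𝔼 h
𝔼-+ {zero}  g h = refl
𝔼-+ {suc m} g h =
  trans (cong (½ *_) (cong₂ _+_ (𝔼-+ (g ∘ (false ∷_)) (h ∘ (false ∷_))) (𝔼-+ (g ∘ (true ∷_)) (h ∘ (true ∷_)))))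
        (rearrange (𝔼 (g ∘ (false ∷_))) (𝔼 (h ∘ (false ∷_))) (𝔼 (g ∘ (true ∷_))) (𝔼 (h ∘ (true ∷_))))
  where
  open +-*-Solver
  rearrange : ∀ a b c d → ½ * ((a + b) + (c + d)) ≡ ½ * (a + c) + ½ * (b + d)
  rearrange = solve 4 (λ a b c d → con ½ :* ((a :+ b) :+ (c :+ d)) := con ½ :* (a :+ c) :+ con ½ :* (b :+ d)) refl

𝔼-* : ∀ {m} q (g : Vec Bool m → ℚ) → 𝔼 (λ u → q * g u) ≡ q * 𝔼 g
𝔼-* {zero}  q g = refl
𝔼-* {suc m} q g =
  trans (cong (½ *_) (cong₂ _+_ (𝔼-* q (g ∘ (false ∷_))) (𝔼-* q (g ∘ (true ∷_)))))
        (rearrange q (𝔼 (g ∘ (false ∷_))) (𝔼 (g ∘ (true ∷_))))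
  where
  open +-*-Solver
  rearrange : ∀ q a b → ½ * (q * a + q * b) ≡ q * (½ * (a + b))
  rearrange = solve 3 (λ q a b → con ½ :* (q :* a :+ q :* b) := q :* (con ½ :* (a :+ b))) refl

𝔼-const : ∀ m q → 𝔼 {m} (const q) ≡ q
𝔼-const zero    q = refl
𝔼-const (suc m) q = trans (cong (½ *_) (cong₂ _+_ (𝔼-const m q) (𝔼-const m q))) (halves q)
  where
  open +-*-Solver
  halves : ∀ q → ½ * (q + q) ≡ q
  halves = solve 1 (λ q → con ½ :* (q :+ q) := q) refl

𝔼-mono : ∀ {m} {g h : Vec Bool m → ℚ} → (∀ u → g u ≤ h u) → 𝔼 g ≤ 𝔼 h
𝔼-mono {zero}  g≤h = g≤h []
𝔼-mono {suc m} g≤h = ℚ.*-monoˡ-≤-nonNeg ½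
  (ℚ.+-mono-≤ (𝔼-mono (g≤h ∘ (false ∷_))) (𝔼-mono (g≤h ∘ (true ∷_))))

sign : Bool → ℚ
sign false = 1ℚ
sign true  = - 1ℚ

sign-xor : ∀ a b → sign (a xor b) ≡ sign a * sign b
sign-xor false b     = sym (ℚ.*-identityˡ (sign b))
sign-xor true  false = refl
sign-xor true  true  = refl

-- Orthogonality of characters: at the first `true` entry of `p` the two halves of the average are
-- negatives of each other.
𝔼-sign : ∀ {m} (p : Vec Bool m) → p ≢ 𝟎 → 𝔼 (λ u → sign ⟨ u , p ⟩) ≡ 0ℚ
𝔼-sign []          p≢𝟎 = contradiction refl p≢𝟎
𝔼-sign (false ∷ p) p≢𝟎 = cong (λ q → ½ * (q + q)) (𝔼-sign p (p≢𝟎 ∘ cong (false ∷_)))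
𝔼-sign (true ∷ p)  _   = begin
  ½ * (a + 𝔼 (λ u → sign (not ⟨ u , p ⟩)))
    ≡⟨ cong (λ q → ½ * (a + q)) (trans (𝔼-cong (λ u → sign-xor true ⟨ u , p ⟩)) (𝔼-* (- 1ℚ) (λ u → sign ⟨ u , p ⟩))) ⟩
  ½ * (a + - 1ℚ * a)
    ≡⟨ cancel a ⟩
  0ℚ ∎
  where
  open ≡-Reasoning
  open +-*-Solver using (solve; con; _:+_; _:*_; _:=_)
  a = 𝔼 (λ u → sign ⟨ u , p ⟩)
  cancel : ∀ a → ½ * (a + - 1ℚ * a) ≡ 0ℚ
  cancel = solve 1 (λ a → con ½ :* (a :+ con (- 1ℚ) :* a) := con 0ℚ) refl

-- Characters and decision trees

χ : ∀ {n} → Vec Bool n → Input n → ℚ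
χ s x = sign ⟨ s , x ⟩

outputs : ∀ {n} → Bool → DecisionTree n → Input n → ℚ
outputs b t x = if does (eval t x Bool.≟ b) then 1ℚ else 0ℚ

-- With χᵢ = (-1)^xᵢ, querying xᵢ gives ½ ((1 + χᵢ) g₀ + (1 − χᵢ) g₁); flipping the
-- i-th entry of s multiplies χ s by χᵢ and raises its weight by at most one.
χ-outputs-query : ∀ {n} s b i (t₀ t₁ : DecisionTree n) x →
  χ s x * outputs b (query i t₀ t₁) x ≡
  ½ * ((χ s x * outputs b t₀ x + χ (flipAt i s) x * outputs b t₀ x) +
       (χ s x * outputs b t₁ x + - 1ℚ * (χ (flipAt i s) x * outputs b t₁ x)))
χ-outputs-query s b i t₀ t₁ x
  rewrite ⟨⟩-flipAt i s x | sign-xor (lookup x i) ⟨ s , x ⟩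
  with lookup x i
... | false = solve 3 (λ c f g →
        c :* f := con ½ :* ((c :* f :+ con 1ℚ :* c :* f) :+ (c :* g :+ con (- 1ℚ) :* (con 1ℚ :* c :* g))))
        refl (χ s x) (outputs b t₀ x) (outputs b t₁ x)
  where open +-*-Solver
... | true  = solve 3 (λ c f g →
        c :* g := con ½ :* ((c :* f :+ con (- 1ℚ) :* c :* f) :+ (c :* g :+ con (- 1ℚ) :* (con (- 1ℚ) :* c :* g))))
        refl (χ s x) (outputs b t₀ x) (outputs b t₁ x)
  where open +-*-Solver

-- This is `Pr` on a bare list of weighted trees. The tail of a distribution need not have total
-- weight 1, so inductions over the outcomes run on lists.
prob : ∀ {n d} → List (ℚ × BoundedTree n d) → Bool → Input n → ℚ
prob W b x = sum (map (λ (w , t , _) → if does (eval t x Bool.≟ b) then w else 0ℚ) W)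

prob-total : ∀ {n d} (W : List (ℚ × BoundedTree n d)) x →
             prob W false x + prob W true x ≡ sum (map proj₁ W)
prob-total []                x = refl
prob-total ((w , t , _) ∷ W) x with eval t x
... | false = trans (solve 3 (λ w a b → (w :+ a) :+ (con 0ℚ :+ b) := w :+ (a :+ b)) refl w (prob W false x) (prob W true x))
                    (cong (_+_ w) (prob-total W x))
  where open +-*-Solver
... | true  = trans (solve 3 (λ w a b → (con 0ℚ :+ a) :+ (w :+ b) := w :+ (a :+ b)) refl w (prob W false x) (prob W true x))
                    (cong (_+_ w) (prob-total W x))
  where open +-*-Solver

-- Functions with equal averages over two families of inputs

module _ {m n} (E₀ E₁ : Vec Bool m → Input n) where

  Fooled : (Input n → ℚ) → Set
  Fooled g = 𝔼 (g ∘ E₀) ≡ 𝔼 (g ∘ E₁)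

  fooled-resp : ∀ {g h} → g ≗ h → Fooled h → Fooled g
  fooled-resp g≗h eq = trans (𝔼-cong (g≗h ∘ E₀)) (trans eq (sym (𝔼-cong (g≗h ∘ E₁))))

  fooled-+ : ∀ {g h} → Fooled g → Fooled h → Fooled (λ x → g x + h x)
  fooled-+ {g} {h} p q = trans (𝔼-+ (g ∘ E₀) (h ∘ E₀)) (trans (cong₂ _+_ p q) (sym (𝔼-+ (g ∘ E₁) (h ∘ E₁))))

  fooled-* : ∀ {g} q → Fooled g → Fooled (λ x → q * g x)
  fooled-* {g} q p = trans (𝔼-* q (g ∘ E₀)) (trans (cong (q *_) p) (sym (𝔼-* q (g ∘ E₁))))

  module _ {k} (fooled-χ : ∀ s → ∣ s ∣ ℕ.≤ k → Fooled (χ s)) where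

    -- The factor `χ s` strengthens the induction: it is the character accumulated on the way down
    -- from the root. A query adds at most one to the weight of `s` and removes at least one from
    -- the depth, so the bound on their sum is kept.
    fooled-χ-outputs : ∀ b (t : DecisionTree n) s → ∣ s ∣ ℕ.+ depth t ℕ.≤ k →
                       Fooled (λ x → χ s x * outputs b t x)
    fooled-χ-outputs b (leaf c) s le =
      -- At a leaf the output is constant, and only a multiple of `χ s` remains.
      fooled-resp {h = λ x → value * χ s x} (λ x → ℚ.*-comm (χ s x) value)
        (fooled-* {χ s} value (fooled-χ s (ℕ.m+n≤o⇒m≤o ∣ s ∣ le)))
      where
      value : ℚ
      value = if does (c Bool.≟ b) then 1ℚ else 0ℚ
    fooled-χ-outputs b (query i t₀ t₁) s le =
      fooled-resp (χ-outputs-query s b i t₀ t₁)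
        (fooled-* {λ x → (part s t₀ x + part s′ t₀ x) + (part s t₁ x + - 1ℚ * part s′ t₁ x)} ½
          (fooled-+ {λ x → part s t₀ x + part s′ t₀ x} {λ x → part s t₁ x + - 1ℚ * part s′ t₁ x}
            (fooled-+ {part s t₀} {part s′ t₀}
              (fooled-χ-outputs b t₀ s (kept t₀ (ℕ.m≤m⊔n _ _)))
              (fooled-χ-outputs b t₀ s′ (flipped t₀ (ℕ.m≤m⊔n _ _))))
            (fooled-+ {part s t₁} {λ x → - 1ℚ * part s′ t₁ x}
              (fooled-χ-outputs b t₁ s (kept t₁ (ℕ.m≤n⊔m _ _)))
              (fooled-* {part s′ t₁} (- 1ℚ) (fooled-χ-outputs b t₁ s′ (flipped t₁ (ℕ.m≤n⊔m _ _)))))))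
      where
      s′ : Vec Bool n
      s′ = flipAt i s
      part : Vec Bool n → DecisionTree n → Input n → ℚ
      part s t x = χ s x * outputs b t x
      flipped : ∀ t → depth t ℕ.≤ depth t₀ ℕ.⊔ depth t₁ → ∣ s′ ∣ ℕ.+ depth t ℕ.≤ k
      flipped t t≤ = ℕ.≤-trans (ℕ.+-mono-≤ (∣flipAt∣≤ i s) t≤)
        (subst (ℕ._≤ k) (ℕ.+-suc ∣ s ∣ _) le)
      kept : ∀ t → depth t ℕ.≤ depth t₀ ℕ.⊔ depth t₁ → ∣ s ∣ ℕ.+ depth t ℕ.≤ k
      kept t t≤ = ℕ.≤-trans (ℕ.+-monoʳ-≤ ∣ s ∣ (ℕ.m≤n⇒m≤1+n t≤)) le

    -- The induction above is started at `𝟎`, whose character is constantly 1.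
    fooled-outputs : ∀ b (t : DecisionTree n) → depth t ℕ.≤ k → Fooled (outputs b t)
    fooled-outputs b t t≤k = fooled-resp {outputs b t} {λ x → χ 𝟎 x * outputs b t x}
      (λ x → sym (trans (cong (λ c → sign c * outputs b t x) (⟨⟩-𝟎ˡ x)) (ℚ.*-identityˡ (outputs b t x))))
      (fooled-χ-outputs b t 𝟎 (subst (λ z → z ℕ.+ depth t ℕ.≤ k) (sym (∣𝟎∣≡0 n)) t≤k))

    fooled-prob : ∀ {d} → d ℕ.≤ k → (W : List (ℚ × BoundedTree n d)) → ∀ b → Fooled (prob W b)
    fooled-prob d≤k []                  b = refl
    fooled-prob d≤k ((w , t , t≤d) ∷ W) b =
      fooled-resp {h = λ x → w * outputs b t x + prob W b x}
        (λ x → cong (_+ prob W b x) (scale (does (eval t x Bool.≟ b))))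
        (fooled-+ {λ x → w * outputs b t x} {prob W b}
          (fooled-* {outputs b t} w (fooled-outputs b t (ℕ.≤-trans t≤d d≤k)))
          (fooled-prob d≤k W b))
      where
      scale : ∀ c → (if c then w else 0ℚ) ≡ w * (if c then 1ℚ else 0ℚ)
      scale false = sym (ℚ.*-zeroʳ w)
      scale true  = sym (ℚ.*-identityʳ w)

    -- For d ≤ k the average probability of output 0 is the same over both families. Correctness
    -- makes it at least 2/3, and likewise the average probability of output 1 over `E₁`; but over
    -- `E₁` the two add up to 1.
    fooled⇒R> : ∀ {f : PartialFunction n} →
                (∀ u → f (E₀ u) ≡ just false) → (∀ u → f (E₁ u) ≡ just true) →
                ∀ d → RandomizedlyComputableIn f d → k ℕ.< d
    fooled⇒R> f∘E₀ f∘E₁ d (D , correct) = ℕ.≰⇒> λ d≤k →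
      from-no (+ 2 / 3 + + 2 / 3 ℚ.≤? 1ℚ) (begin
        + 2 / 3 + + 2 / 3
          ≡⟨ cong₂ _+_ (𝔼-const m (+ 2 / 3)) (𝔼-const m (+ 2 / 3)) ⟨
        𝔼 {m} (const (+ 2 / 3)) + 𝔼 {m} (const (+ 2 / 3))
          ≤⟨ ℚ.+-mono-≤ (𝔼-mono (λ u → correct false (E₀ u , f∘E₀ u)))
                        (𝔼-mono (λ u → correct true (E₁ u , f∘E₁ u))) ⟩
        𝔼 (prob W false ∘ E₀) + 𝔼 (prob W true ∘ E₁)
          ≡⟨ cong (_+ 𝔼 (prob W true ∘ E₁)) (fooled-prob d≤k W false) ⟩
        𝔼 (prob W false ∘ E₁) + 𝔼 (prob W true ∘ E₁)
          ≡⟨ 𝔼-+ (prob W false ∘ E₁) (prob W true ∘ E₁) ⟨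
        𝔼 (λ u → prob W false (E₁ u) + prob W true (E₁ u))
          ≡⟨ 𝔼-cong (λ u → trans (prob-total W (E₁ u)) (Distribution.total D)) ⟩
        𝔼 {m} (const 1ℚ)
          ≡⟨ 𝔼-const m 1ℚ ⟩
        1ℚ ∎)
      where
      open ℚ.≤-Reasoning
      W = Distribution.weighted D

-- Either `combine P s` vanishes, and then `s` is `𝟎` by independence and its character is constant;
-- or the average over the code vanishes, and translation by `v` only multiplies it by a sign.
independent⇒fooled-χ : ∀ {m n k} (P : Vec (Vec Bool m) n) → Independent k P → ∀ v s → ∣ s ∣ ℕ.≤ k →
                       Fooled (encode P) (λ u → encode P u ⊕ v) (χ s)
independent⇒fooled-χ {m} P indep v s s≤k with Vec.≡-dec Bool._≟_ (combine P s) 𝟎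
... | yes p≡𝟎 rewrite indep s s≤k p≡𝟎 =
  𝔼-cong (λ u → cong sign (trans (⟨⟩-𝟎ˡ (encode P u)) (sym (⟨⟩-𝟎ˡ (encode P u ⊕ v)))))
... | no  p≢𝟎 = trans vanishes (sym (begin
  𝔼 (λ u → χ s (encode P u ⊕ v))               ≡⟨ 𝔼-cong χ-shift ⟩
  𝔼 (λ u → sign ⟨ s , v ⟩ * χ s (encode P u))  ≡⟨ 𝔼-* (sign ⟨ s , v ⟩) (χ s ∘ encode P) ⟩
  sign ⟨ s , v ⟩ * 𝔼 (χ s ∘ encode P)          ≡⟨ cong (sign ⟨ s , v ⟩ *_) vanishes ⟩
  sign ⟨ s , v ⟩ * 0ℚ                          ≡⟨ ℚ.*-zeroʳ (sign ⟨ s , v ⟩) ⟩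
  0ℚ                                           ∎))
  where
  open ≡-Reasoning
  vanishes : 𝔼 (χ s ∘ encode P) ≡ 0ℚ
  vanishes = trans (𝔼-cong (λ u → cong sign (⟨⟩-encode P s u))) (𝔼-sign (combine P s) p≢𝟎)
  χ-shift : ∀ u → χ s (encode P u ⊕ v) ≡ sign ⟨ s , v ⟩ * χ s (encode P u)
  χ-shift u = trans (cong sign (⟨⟩-⊕ʳ s (encode P u) v))
    (trans (sign-xor ⟨ s , encode P u ⟩ ⟨ s , v ⟩) (ℚ.*-comm (χ s (encode P u)) (sign ⟨ s , v ⟩)))

-- Natural numbers as rationals

fromℕ-suc : ∀ n → fromℕ (suc n) ≡ 1ℚ + fromℕ n
fromℕ-suc n = ℚ.toℚᵘ-injective (begin
  -- `fromℕ n` is reduced by a gcd, which does not compute for a variable `n`; the equation is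
  -- therefore checked on unnormalised fractions.
  toℚᵘ (fromℕ (suc n))              ≈⟨ ℚ.toℚᵘ-fromℚᵘ (ℚᵘ.mkℚᵘ (+ suc n) 0) ⟩
  ℚᵘ.mkℚᵘ (+ suc n) 0                 ≈⟨ ℚᵘ.*≡* (cong (λ i → (+ 1 ℤ.+ i) ℤ.* + 1) (sym (ℤ.*-identityʳ (+ n)))) ⟩
  ℚᵘ.1ℚᵘ ℚᵘ.+ ℚᵘ.mkℚᵘ (+ n) 0         ≈⟨ ℚᵘ.+-congʳ ℚᵘ.1ℚᵘ (ℚ.toℚᵘ-fromℚᵘ (ℚᵘ.mkℚᵘ (+ n) 0)) ⟨
  ℚᵘ.1ℚᵘ ℚᵘ.+ toℚᵘ (fromℕ n)        ≈⟨ ℚ.toℚᵘ-homo-+ 1ℚ (fromℕ n) ⟨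
  toℚᵘ (1ℚ + fromℕ n)               ∎)
  where
  open import Relation.Binary.Reasoning.Setoid ℚᵘ.≃-setoid

0≤fromℕ : ∀ n → 0ℚ ≤ fromℕ n
0≤fromℕ zero    = ℚ.≤-refl
0≤fromℕ (suc n) = subst (0ℚ ≤_) (sym (fromℕ-suc n))
  (ℚ.+-mono-≤ (from-yes (0ℚ ℚ.≤? 1ℚ)) (0≤fromℕ n))

0<fromℕ-suc : ∀ n → 0ℚ < fromℕ (suc n)
0<fromℕ-suc n = subst (0ℚ <_) (sym (fromℕ-suc n))
  (ℚ.+-mono-<-≤ (from-yes (0ℚ ℚ.<? 1ℚ)) (0≤fromℕ n))

fromℕ-mono-≤ : ∀ {m n} → m ℕ.≤ n → fromℕ m ≤ fromℕ n
fromℕ-mono-≤ {n = n} z≤n = 0≤fromℕ n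
fromℕ-mono-≤ {suc m} {suc n} (s≤s m≤n) =
  subst₂ _≤_ (sym (fromℕ-suc m)) (sym (fromℕ-suc n)) (ℚ.+-monoʳ-≤ 1ℚ (fromℕ-mono-≤ m≤n))

[1+q]*r : ∀ q r → (1ℚ + q) * r ≡ r + q * r
[1+q]*r q r = trans (ℚ.*-distribʳ-+ r 1ℚ q) (cong (_+ q * r) (ℚ.*-identityˡ r))

fromℕ-+ : ∀ m n → fromℕ (m ℕ.+ n) ≡ fromℕ m + fromℕ n
fromℕ-+ zero    n = sym (ℚ.+-identityˡ (fromℕ n))
fromℕ-+ (suc m) n = begin
  fromℕ (suc m ℕ.+ n)        ≡⟨ fromℕ-suc (m ℕ.+ n) ⟩
  1ℚ + fromℕ (m ℕ.+ n)       ≡⟨ cong (_+_ 1ℚ) (fromℕ-+ m n) ⟩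
  1ℚ + (fromℕ m + fromℕ n)   ≡⟨ ℚ.+-assoc 1ℚ (fromℕ m) (fromℕ n) ⟨
  1ℚ + fromℕ m + fromℕ n     ≡⟨ cong (_+ fromℕ n) (fromℕ-suc m) ⟨
  fromℕ (suc m) + fromℕ n    ∎
  where open ≡-Reasoning

fromℕ-* : ∀ m n → fromℕ (m ℕ.* n) ≡ fromℕ m * fromℕ n
fromℕ-* zero    n = sym (ℚ.*-zeroˡ (fromℕ n))
fromℕ-* (suc m) n = begin
  fromℕ (n ℕ.+ m ℕ.* n)         ≡⟨ fromℕ-+ n (m ℕ.* n) ⟩
  fromℕ n + fromℕ (m ℕ.* n)     ≡⟨ cong (_+_ (fromℕ n)) (fromℕ-* m n) ⟩
  fromℕ n + fromℕ m * fromℕ n   ≡⟨ [1+q]*r (fromℕ m) (fromℕ n) ⟨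
  (1ℚ + fromℕ m) * fromℕ n      ≡⟨ cong (_* fromℕ n) (fromℕ-suc m) ⟨
  fromℕ (suc m) * fromℕ n       ∎
  where open ≡-Reasoning

-- Certificate games between sets that are far apart

sum-tabulate-const : ∀ n w → sum (tabulate {n = n} (const w)) ≡ fromℕ n * w
sum-tabulate-const zero    w = sym (ℚ.*-zeroˡ w)
sum-tabulate-const (suc n) w = begin
  w + sum (tabulate {n = n} (const w))  ≡⟨ cong (_+_ w) (sum-tabulate-const n w) ⟩
  w + fromℕ n * w                       ≡⟨ [1+q]*r (fromℕ n) w ⟨
  (1ℚ + fromℕ n) * w                    ≡⟨ cong (_* w) (fromℕ-suc n) ⟨
  fromℕ (suc n) * w                     ∎
  where open ≡-Reasoning

sum-tabulate-lookup : ∀ {n} (z : Vec Bool n) w →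
  sum (tabulate (λ i → if lookup z i then w else 0ℚ)) ≡ fromℕ ∣ z ∣ * w
sum-tabulate-lookup []          w = sym (ℚ.*-zeroˡ w)
sum-tabulate-lookup (false ∷ z) w =
  trans (ℚ.+-identityˡ _) (sum-tabulate-lookup z w)
sum-tabulate-lookup (true ∷ z)  w = begin
  w + sum (tabulate (λ i → if lookup z i then w else 0ℚ))
    ≡⟨ cong (_+_ w) (sum-tabulate-lookup z w) ⟩
  w + fromℕ ∣ z ∣ * w
    ≡⟨ [1+q]*r (fromℕ ∣ z ∣) w ⟨
  (1ℚ + fromℕ ∣ z ∣) * w
    ≡⟨ cong (_* w) (fromℕ-suc ∣ z ∣) ⟨
  fromℕ (suc ∣ z ∣) * w ∎
  where open ≡-Reasoning

inverse-≤ : ∀ {p c} → 0ℚ ≤ p → 1ℚ ≤ c * p → inverse p ≤⁺ [ c ]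
inverse-≤ {p} {c} 0≤p 1≤c*p with p ℚ.≟ 0ℚ
-- The value +∞ is excluded: with p = 0 the hypothesis would read 1 ≤ 0.
... | yes refl = contradiction (subst (1ℚ ≤_) (ℚ.*-zeroʳ c) 1≤c*p) (from-no (1ℚ ℚ.≤? 0ℚ))
... | no  p≢0  = [ ℚ.*-cancelʳ-≤-pos p {{p>0}} (subst (_≤ c * p) (sym (ℚ.*-inverseˡ p)) 1≤c*p) ]
  where
  instance
    p≠0 = ≢-nonZero p≢0
  p>0 : Positive p
  p>0 = ℚ.nonNeg∧nonZero⇒pos p {{nonNegative 0≤p}}

module _ {n} (f : PartialFunction n) (C : ℕ)
  (far : ∀ ((x , _) : f ⁻¹[ false ]) ((y , _) : f ⁻¹[ true ]) → n ℕ.≤ C ℕ.* ∣ x ⊕ y ∣)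
  (w : ℚ) (0≤w : 0ℚ ≤ w) (n*w≡1 : fromℕ n * w ≡ 1ℚ)
  where

  -- Both players ignore their inputs and name the public random index `i`.
  constantPair : Fin n → ℚ × Strategy f
  constantPair i = w , const i , const i

  uniform : Distribution (Strategy f)
  uniform = record
    { weighted    = tabulate constantPair
    ; nonNegative = tabulate⁺ (λ _ → 0≤w)
    ; total       = trans (cong sum (map-tabulate constantPair proj₁))
                          (trans (sum-tabulate-const n w) n*w≡1)
    }

  differ : ∀ a b → not (does (a Bool.≟ b)) ≡ a xor b
  differ false false = refl
  differ false true  = refl
  differ true  false = refl
  differ true  true  = refl

  correct-i : ∀ x y i → does (correct? f x y (const i , const i)) ≡ lookup (proj₁ x ⊕ proj₁ y) i
  correct-i (x , _) (y , _) i = trans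
    (cong₂ _∧_ (dec-true (i Fin.≟ i) refl) (differ (lookup x i) (lookup y i)))
    (sym (Vec.lookup-zipWith _xor_ i x y))

  -- The winning indices are exactly the places where the inputs differ, and each carries weight
  -- `w`, which is 1/n.
  Pr≡ : ∀ x y → Pr uniform (correct? f x y) ≡ fromℕ ∣ proj₁ x ⊕ proj₁ y ∣ * w
  Pr≡ x y = begin
    Pr uniform (correct? f x y)
      ≡⟨ cong sum (map-tabulate constantPair _) ⟩
    sum (tabulate (λ i → if does (correct? f x y (const i , const i)) then w else 0ℚ))
      ≡⟨ cong sum (tabulate-cong (λ i → cong (λ c → if c then w else 0ℚ) (correct-i x y i))) ⟩
    sum (tabulate (λ i → if lookup (proj₁ x ⊕ proj₁ y) i then w else 0ℚ))
      ≡⟨ sum-tabulate-lookup (proj₁ x ⊕ proj₁ y) w ⟩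
    fromℕ ∣ proj₁ x ⊕ proj₁ y ∣ * w ∎
    where open ≡-Reasoning

  farApart⇒inverse≤ : ∀ x y → inverse (Pr uniform (correct? f x y)) ≤⁺ [ fromℕ C ]
  farApart⇒inverse≤ x y = subst (λ p → inverse p ≤⁺ [ fromℕ C ]) (sym (Pr≡ x y)) (inverse-≤ 0≤δw 1≤Cδw)
    where
    open ℚ.≤-Reasoning
    instance
      w≥0 : NonNegative w
      w≥0 = nonNegative 0≤w
    δ = ∣ proj₁ x ⊕ proj₁ y ∣
    0≤δw : 0ℚ ≤ fromℕ δ * w
    0≤δw = subst (_≤ fromℕ δ * w) (ℚ.*-zeroˡ w) (ℚ.*-monoʳ-≤-nonNeg w (0≤fromℕ δ))
    1≤Cδw : 1ℚ ≤ fromℕ C * (fromℕ δ * w)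
    1≤Cδw = begin
      1ℚ                          ≡⟨ n*w≡1 ⟨
      fromℕ n * w                 ≤⟨ ℚ.*-monoʳ-≤-nonNeg w (fromℕ-mono-≤ (far x y)) ⟩
      fromℕ (C ℕ.* δ) * w         ≡⟨ cong (_* w) (fromℕ-* C δ) ⟩
      fromℕ C * fromℕ δ * w       ≡⟨ ℚ.*-assoc (fromℕ C) (fromℕ δ) w ⟩
      fromℕ C * (fromℕ δ * w)     ∎

farApart⇒CGpub≤ : ∀ {n} .{{_ : ℕ.NonZero n}} (f : PartialFunction n) C →
  (∀ ((x , _) : f ⁻¹[ false ]) ((y , _) : f ⁻¹[ true ]) → n ℕ.≤ C ℕ.* ∣ x ⊕ y ∣) →
  CGpub[ f ]≤ fromℕ C
farApart⇒CGpub≤ {n@(suc n-1)} f C far =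
  uniform f C far w 0≤w n*w≡1 , farApart⇒inverse≤ f C far w 0≤w n*w≡1
  where
  instance
    n>0 : Positive (fromℕ n)
    n>0 = positive (0<fromℕ-suc n-1)
    n≠0 = ℚ.pos⇒nonZero (fromℕ n)
  w : ℚ
  w = 1/ fromℕ n
  0≤w : 0ℚ ≤ w
  0≤w = ℚ.<⇒≤ (ℚ.positive⁻¹ w {{ℚ.1/pos⇒pos (fromℕ n)}})
  n*w≡1 : fromℕ n * w ≡ 1ℚ
  n*w≡1 = ℚ.*-inverseʳ (fromℕ n)

-- The partial function of a code and its coset

module _ {n : ℕ} where
  open DecMembership (Vec.≡-dec {n = n} Bool._≟_) using (_∈?_)

  -- Membership in `X` is tested first, so a point of both lists gets the value 0; this is why
  -- `separating-true` asks for `x ∉ X`.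
  separating : List (Input n) → List (Input n) → PartialFunction n
  separating X Y x = if does (x ∈? X) then just false
                     else if does (x ∈? Y) then just true
                     else nothing

  separating-false : ∀ X Y {x} → x ∈ X → separating X Y x ≡ just false
  separating-false X Y {x} x∈X rewrite dec-true (x ∈? X) x∈X = refl

  separating-true : ∀ X Y {x} → x ∉ X → x ∈ Y → separating X Y x ≡ just true
  separating-true X Y {x} x∉X x∈Y rewrite dec-false (x ∈? X) x∉X | dec-true (x ∈? Y) x∈Y = refl

  separating-false⁻ : ∀ X Y {x} → separating X Y x ≡ just false → x ∈ X
  separating-false⁻ X Y {x} eq with x ∈? X
  ... | yes x∈X = x∈X
  ... | no  _ with x ∈? Y
  ...   | yes _ = contradiction eq λ ()
  ...   | no  _ = contradiction eq λ ()

  separating-true⁻ : ∀ X Y {x} → separating X Y x ≡ just true → x ∈ Y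
  separating-true⁻ X Y {x} eq with x ∈? X
  ... | yes _ = contradiction eq λ ()
  ... | no  _ with x ∈? Y
  ...   | yes x∈Y = x∈Y
  ...   | no  _   = contradiction eq λ ()

cosetFunction : ∀ {m n} → Vec (Vec Bool m) n → Vec Bool n → PartialFunction n
cosetFunction P v = separating (map (encode P) (words _)) (map (λ u → encode P u ⊕ v) (words _))

module _ {m n k} (P : Vec (Vec Bool m) n) (v : Vec Bool n) (far : ∀ u → k ℕ.< ∣ encode P u ⊕ v ∣) where

  private
    X Y : List (Input n)
    X = map (encode P) (words m)
    Y = map (λ u → encode P u ⊕ v) (words m)

  -- By linearity the sum of two codewords is again a codeword, so the distance of `v` from the code
  -- bounds all distances between code and coset.
  far-differences : ∀ u u′ → k ℕ.< ∣ encode P u ⊕ (encode P u′ ⊕ v) ∣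
  far-differences u u′ = subst (λ z → k ℕ.< ∣ z ∣)
    (trans (cong (_⊕ v) (encode-⊕ P u u′)) (Vec.zipWith-assoc Bool.xor-assoc (encode P u) (encode P u′) v))
    (far (u ⊕ u′))

  cosetFunction-false : ∀ u → cosetFunction P v (encode P u) ≡ just false
  cosetFunction-false u = separating-false X Y (∈-map⁺ (encode P) (∈-words u))

  cosetFunction-true : ∀ u → cosetFunction P v (encode P u ⊕ v) ≡ just true
  cosetFunction-true u = separating-true X Y disjoint (∈-map⁺ (λ u → encode P u ⊕ v) (∈-words u))
    where
    disjoint : encode P u ⊕ v ∉ X
    -- A common point of code and coset would have distance 0 from itself, yet more than `k`.
    disjoint y∈X with u′ , _ , eq ← ∈-map⁻ (encode P) y∈X = contradiction
      (subst (k ℕ.<_) (∣x⊕x∣≡0 (encode P u′))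
        (subst (λ y → k ℕ.< ∣ encode P u′ ⊕ y ∣) eq (far-differences u′ u)))
      ℕ.n≮0

  cosetFunction-farApart : ∀ ((x , _) : cosetFunction P v ⁻¹[ false ]) ((y , _) : cosetFunction P v ⁻¹[ true ]) →
                           k ℕ.< ∣ x ⊕ y ∣
  cosetFunction-farApart (x , fx) (y , fy)
    with u , _ , refl ← ∈-map⁻ (encode P) (separating-false⁻ X Y fx)
       | u′ , _ , refl ← ∈-map⁻ (λ u → encode P u ⊕ v) (separating-true⁻ X Y fy)
    = far-differences u u′

-- Choice of parameters

n≤20[1+n/20] : ∀ n → n ℕ.≤ 20 ℕ.* suc (n ℕ./ 20)
n≤20[1+n/20] n = begin
  n                                 ≡⟨ m≡m%n+[m/n]*n n 20 ⟩
  n ℕ.% 20 ℕ.+ n ℕ./ 20 ℕ.* 20      ≤⟨ ℕ.+-monoˡ-≤ (n ℕ./ 20 ℕ.* 20) (ℕ.<⇒≤ (m%n<n n 20)) ⟩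
  suc (n ℕ./ 20) ℕ.* 20             ≡⟨ ℕ.*-comm (suc (n ℕ./ 20)) 20 ⟩
  20 ℕ.* suc (n ℕ./ 20)             ∎
  where open ℕ.≤-Reasoning

-- With m = 10 k, one estimate, volume below 2^m, serves both counts: it leaves room for each new
-- column, and it makes the balls about the codewords fill less than 2^(2m) ≤ 2^n points, since 2m =
-- 20 k ≤ n.
codeWithFarVector : ∀ n k → 2 ℕ.≤ k → k ℕ.* 20 ℕ.≤ n → n ℕ.≤ 20 ℕ.* suc k →
  ∃ λ (P : Vec (Vec Bool (10 ℕ.* k)) n) → Independent k P × ∃ λ v → ∀ u → k ℕ.< ∣ encode P u ⊕ v ∣
codeWithFarVector n k 2≤k 20k≤n n≤20[1+k] =
  let P , indep = independentColumns m n k ball< in P , indep , farVector P k cover<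
  where
  m : ℕ
  m = 10 ℕ.* k
  ball< : length (ball n k) ℕ.< 2 ℕ.^ m
  ball< = length-ball< n k 2≤k n≤20[1+k]
  cover< : 2 ℕ.^ m ℕ.* length (ball n k) ℕ.< 2 ℕ.^ n
  cover< = begin-strict
    2 ℕ.^ m ℕ.* length (ball n k)  <⟨ ℕ.*-monoʳ-< (2 ℕ.^ m) {{ℕ.m^n≢0 2 m}} ball< ⟩
    2 ℕ.^ m ℕ.* 2 ℕ.^ m            ≡⟨ ℕ.^-distribˡ-+-* 2 m m ⟨
    2 ℕ.^ (m ℕ.+ m)                ≤⟨ ℕ.^-monoʳ-≤ 2 (ℕ.≤-trans (ℕ.≤-reflexive (double k)) 20k≤n) ⟩
    2 ℕ.^ n                        ∎
    where
    open ℕ.≤-Reasoning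
    double : ∀ k → 10 ℕ.* k ℕ.+ 10 ℕ.* k ≡ k ℕ.* 20
    double = ℕ-solve-∀

n/20≤d : ∀ n d → n ℕ.≤ 20 ℕ.* d → + 1 / 20 * fromℕ n ≤ fromℕ d
n/20≤d n d n≤20d = begin
  + 1 / 20 * fromℕ n               ≤⟨ ℚ.*-monoˡ-≤-nonNeg (+ 1 / 20) (fromℕ-mono-≤ n≤20d) ⟩
  + 1 / 20 * fromℕ (20 ℕ.* d)      ≡⟨ cong (_*_ (+ 1 / 20)) (fromℕ-* 20 d) ⟩
  + 1 / 20 * (fromℕ 20 * fromℕ d)  ≡⟨ ℚ.*-assoc (+ 1 / 20) (fromℕ 20) (fromℕ d) ⟨
  + 1 / 20 * fromℕ 20 * fromℕ d    ≡⟨ cong (_* fromℕ d) 1/20*20≡1 ⟩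
  1ℚ * fromℕ d                     ≡⟨ ℚ.*-identityˡ (fromℕ d) ⟩
  fromℕ d                          ∎
  where
  open ℚ.≤-Reasoning
  1/20*20≡1 : + 1 / 20 * fromℕ 20 ≡ 1ℚ
  1/20*20≡1 = refl

-- Both the depth and the distance between inputs exceed `k`, hence are at least k + 1, and n ≤ 20
-- (k + 1) turns each into a bound by n/20. The strictness absorbs the rounding in k = n/20.
cosetFunction-separation : ∀ {m n k} .{{_ : ℕ.NonZero n}} → n ℕ.≤ 20 ℕ.* suc k →
  (P : Vec (Vec Bool m) n) → Independent k P → ∀ v → (∀ u → k ℕ.< ∣ encode P u ⊕ v ∣) →
  (R[ cosetFunction P v ]≥ (+ 1 / 20 * fromℕ n)) × (CGpub[ cosetFunction P v ]≤ fromℕ 20)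
cosetFunction-separation {n = n} {k} n≤20[1+k] P indep v far =
  R≥ , farApart⇒CGpub≤ (cosetFunction P v) 20
    (λ x y → ℕ.≤-trans n≤20[1+k] (ℕ.*-monoʳ-≤ 20 (cosetFunction-farApart P v far x y)))
  where
  R≥ : R[ cosetFunction P v ]≥ (+ 1 / 20 * fromℕ n)
  R≥ d computable = n/20≤d n d (ℕ.≤-trans n≤20[1+k] (ℕ.*-monoʳ-≤ 20 k<d))
    where
    k<d : k ℕ.< d
    k<d = fooled⇒R> (encode P) (λ u → encode P u ⊕ v) (independent⇒fooled-χ P indep v)
      (cosetFunction-false P v far) (cosetFunction-true P v far) d computable

lemma9p1 : ∃ λ (c : ℚ) → ∃ λ (C : ℚ) → ∃ λ (n₀ : ℕ) →
    0ℚ < c × 0ℚ < C ×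
    (∀ n → n₀ ℕ.≤ n →
    ∃ λ (f : PartialFunction n) →
    (R[ f ]≥ (c * fromℕ n)) × (CGpub[ f ]≤ C))
-- The threshold 40 gives k = n/20 ≥ 2, as the volume estimate requires.
lemma9p1 = + 1 / 20 , fromℕ 20 , 40 , from-yes (0ℚ ℚ.<? + 1 / 20) , 0<fromℕ-suc 19 , λ n 40≤n →
  let k                   = n ℕ./ 20
      P , indep , v , far = codeWithFarVector n k (/-monoˡ-≤ 20 40≤n) (m/n*n≤m n 20) (n≤20[1+n/20] n)
  in cosetFunction P v ,
     cosetFunction-separation {{ℕ.>-nonZero (ℕ.≤-trans (s≤s z≤n) 40≤n)}} (n≤20[1+n/20] n) P indep v far
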